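{- Let $n$ be a positive integer and let $\varphi(\{NE,D\}^n)=\bigcup_{\gamma\in\{NE,D\}^n}\varphi(\gamma)$, where each sequence $\varphi(\gamma)$ is regarded as the set of its elements. There is a bijection $\Omega_n$ of $\varphi(\{NE,D\}^n)$ onto itself such that, for every $\pi\in\varphi(\{NE,D\}^n)$, $\mathrm{area}(\pi)=\mathrm{bounce}(\Omega_n(\pi))$ and $\mathrm{bounce}(\pi)=\mathrm{area}(\Omega_n(\pi))$.
   Context: Words in $N=(0,1)$, $E=(1,0)$, $D=(1,1)$ are read as lattice paths starting at $(0,0)$. A Schröder path is such a word with as many $N$'s as $E$'s and with $|\omega|_N\ge|\omega|_E$ for every prefix $\omega$; its size is the number of $N$'s plus the number of $D$'s. A Dyck path is a Schröder path without $D$ steps. $\{NE,D\}^n$ is the set of words that are concatenations of $n$ blocks, each equal to $NE$ or $D$. Area: $\mathrm{area}(\gamma)$ is the number of lower triangles (lower halves of unit squares cut along the diagonal from bottom left to top right corner) under the path and above the main diagonal; equivalently the sum of $y-x$ over all $N$ and $D$ steps of $\gamma$, $(x,y)$ being the starting point of the step. Bounce: for a Dyck path of size $k$, the bounce path starts at $(0,0)$, goes north until it reaches the starting point of an east step of the Dyck path, then east until it reaches the main diagonal, then north again, and so on until $(k,k)$; the bounce of the Dyck path is the sum of $k-j$ over all points $(j,j)$, $1\le j\le k$, at which the bounce path returns to the main diagonal. For a Schröder path $\gamma$, let $\Gamma(\gamma)$ be the Dyck path obtained by deleting all $D$ steps. The points where the bounce path of $\Gamma(\gamma)$ turns from north to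 east are starting points of east steps of $\Gamma(\gamma)$; the corresponding east steps of $\gamma$ are the peak steps. Then $\mathrm{numph}(\gamma)$ is the sum over all $D$ steps of $\gamma$ of the number of peak steps preceding that $D$ step in the word, and $\mathrm{bounce}(\gamma)=\mathrm{bounce}(\Gamma(\gamma))+\mathrm{numph}(\gamma)$. Algorithm $\varphi$: for $\gamma\in\{NE,D\}^*$, $\varphi(\gamma)=(\gamma_0,\gamma_1,\dots,\gamma_{\mathrm{bounce}(\gamma)})$, where $\gamma_0=\gamma$ and $\gamma_v$ is obtained from $\gamma_{v-1}=w_1\cdots w_k$ by taking the largest index $i<k$ with $w_i=E$ and $w_{i+1}\ne E$ and exchanging $w_i$ and $w_{i+1}$. -}

module Defs where

open import Data.Bool using (if_then_else_)
open import Data.List using (List; []; _∷_; map; length; filter; find; iterate)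
open import Data.List.Membership.Propositional using (_∈_)
import Data.List.Membership.DecPropositional as DecMembership
open import Data.Maybe using (Maybe; just; nothing; fromMaybe)
open import Data.Nat using (ℕ; zero; suc; _+_; _∸_; _≟_)
open import Data.Nat.ListAction using (sum)
open import Data.Product using (Σ; ∃-syntax; _×_; _,_; proj₁; proj₂)
open import Level using (0ℓ)
open import Relation.Binary.Bundles using (Setoid)
open import Relation.Binary.Definitions using (DecidableEquality)
open import Relation.Binary.PropositionalEquality using (_≡_; refl; setoid)
import Relation.Binary.Construct.On as On
open import Relation.Nullary using (yes; no; does; ¬?)

open DecMembership _≟_ using (_∈?_)

data Step : Set where
  N E D : Step

_≟ˢ_ : DecidableEquality Step
N ≟ˢ N = yes refl
N ≟ˢ E = no λ ()
N ≟ˢ D = no λ ()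
E ≟ˢ N = no λ ()
E ≟ˢ E = yes refl
E ≟ˢ D = no λ ()
D ≟ˢ N = no λ ()
D ≟ˢ E = no λ ()
D ≟ˢ D = yes refl

Word : Set
Word = List Step

Point : Set
Point = ℕ × ℕ

count : Step → Word → ℕ
count s w = length (filter (s ≟ˢ_) w)

-- The functions below are total on words; they carry their geometric meaning
-- on Schröder paths (on which y ∸ x is never truncated).

areaFrom : Point → Word → ℕ
areaFrom (x , y) []      = 0
areaFrom (x , y) (N ∷ w) = (y ∸ x) + areaFrom (x , suc y) w
areaFrom (x , y) (E ∷ w) = areaFrom (suc x , y) w
areaFrom (x , y) (D ∷ w) = (y ∸ x) + areaFrom (suc x , suc y) w

area : Word → ℕ
area = areaFrom (0 , 0)

eastStartsFrom : Point → Word → List Point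
eastStartsFrom (x , y) []      = []
eastStartsFrom (x , y) (N ∷ w) = eastStartsFrom (x , suc y) w
eastStartsFrom (x , y) (E ∷ w) = (x , y) ∷ eastStartsFrom (suc x , y) w
eastStartsFrom (x , y) (D ∷ w) = eastStartsFrom (suc x , suc y) w

eastStarts : Word → List Point
eastStarts = eastStartsFrom (0 , 0)

-- The points where the bounce path, leaving the diagonal northwards at (j , j),
-- turns from north to east.  Going north it stays on the vertical line x = j,
-- on which a Dyck path has at most one east step start, at (j , h) say; going
-- east from there it meets the diagonal at (h , h).  At (k , k) no east step
-- starts on the line and the path ends.  The first argument bounds the number
-- of bounces.
turnsFrom : ℕ → List Point → ℕ → List Point
turnsFrom zero       starts j = []
turnsFrom (suc fuel) starts j with find (λ p → proj₁ p ≟ j) starts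
... | nothing      = []
... | just (x , h) = (x , h) ∷ turnsFrom fuel starts h

-- Each return to the diagonal is strictly further along than the previous one,
-- so a Dyck path of size k has at most k bounces.
turns : Word → List Point
turns δ = turnsFrom (count N δ) (eastStarts δ) 0

dyckBounce : Word → ℕ
dyckBounce δ = sum (map (λ (_ , h) → count N δ ∸ h) (turns δ))

Γ : Word → Word
Γ = filter (λ s → ¬? (s ≟ˢ D))

-- Deleting the D steps preserves the order of the east steps, and an east step
-- of Γ γ preceded by e others starts at abscissa e.  So an east step of γ
-- preceded by e others is a peak step when e is in the list of abscissas of
-- turning points.  In numphFrom, e is the number of east steps and p the number
-- of peak steps read so far.
numphFrom : List ℕ → (e p : ℕ) → Word → ℕ
numphFrom peaks e p []      = 0
numphFrom peaks e p (N ∷ w) = numphFrom peaks e p w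
numphFrom peaks e p (E ∷ w) = numphFrom peaks (suc e) (if does (e ∈? peaks) then suc p else p) w
numphFrom peaks e p (D ∷ w) = p + numphFrom peaks e p w

numph : Word → ℕ
numph γ = numphFrom (map proj₁ (turns (Γ γ))) 0 0 γ

bounce : Word → ℕ
bounce γ = dyckBounce (Γ γ) + numph γ

exchangeHead : Step → Word → Maybe Word
exchangeHead E (N ∷ w) = just (N ∷ E ∷ w)
exchangeHead E (D ∷ w) = just (D ∷ E ∷ w)
exchangeHead _ _       = nothing

-- Exchanges w_i and w_{i+1} for the largest i with w_i = E and w_{i+1} ≠ E;
-- nothing if there is no such i.
exchange : Word → Maybe Word
exchange []      = nothing
exchange (s ∷ w) with exchange w
... | just w′ = just (s ∷ w′)
... | nothing = exchangeHead s w

-- The default is irrelevant to φ: from γ ∈ {NE,D}ⁿ, the algorithm can perform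
-- exactly bounce γ exchanges.
next : Word → Word
next w = fromMaybe w (exchange w)

φ : Word → List Word
φ γ = iterate next γ (suc (bounce γ))

data ⟨NE,D⟩^ : ℕ → Word → Set where
  []   : ⟨NE,D⟩^ 0 []
  NE∷_ : ∀ {n w} → ⟨NE,D⟩^ n w → ⟨NE,D⟩^ (suc n) (N ∷ E ∷ w)
  D∷_  : ∀ {n w} → ⟨NE,D⟩^ n w → ⟨NE,D⟩^ (suc n) (D ∷ w)

_∈φ⟨NE,D⟩^_ : Word → ℕ → Set
π ∈φ⟨NE,D⟩^ n = ∃[ γ ] (⟨NE,D⟩^ n γ × π ∈ φ γ)

-- Elements are compared as words, ignoring the membership proofs.
φ⟨NE,D⟩^ : ℕ → Setoid 0ℓ 0ℓ
φ⟨NE,D⟩^ n = On.setoid {B = Σ Word (_∈φ⟨NE,D⟩^ n)} (setoid Word) proj₁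

{-# OPTIONS --safe #-}
module Submission where

-- Exchanges only move E steps, and a word γ of {NE,D}ⁿ is determined by its N
-- and D steps, so every element π of φ γ determines γ.  Along φ γ the area
-- starts at 0 and each exchange raises it by 1, while area + bounce stays equal
-- to bounce γ: prefixing a word by NE raises its bounce by its number of N and D
-- steps, which is the number of exchanges that carry the new E to the end, and
-- the bounce drops to the number of steps that this E still has to pass.  Hence
-- Ω can reverse each sequence: it sends π ∈ φ γ to the element of φ γ of index
-- bounce π.

open import Defs
open import Data.Bool using (true; false)
open import Data.List using (List; []; _∷_; _++_; map; length; filter; find; iterate; replicate)
open import Data.List.Membership.Propositional using (_∈_)
open import Data.List.Membership.Propositional.Properties using (∈-map⁺; ∈-map⁻)
import Data.List.Membership.DecPropositional as DecMembership
open import Data.List.Properties using (filter-++; length-++; map-∘; ++-assoc; ++-identityʳ)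
open import Data.List.Relation.Unary.All using (All; []; _∷_)
import Data.List.Relation.Unary.All as All
import Data.List.Relation.Unary.All.Properties as All
open import Data.List.Relation.Unary.Any using (here; there)
open import Data.Maybe using (just; nothing)
import Data.Maybe as Maybe
open import Data.Maybe.Relation.Unary.All using (just; nothing) renaming (All to AllMaybe)
open import Data.Nat using (ℕ; zero; suc; _+_; _*_; _∸_; _≤_; _<_; _≟_; z≤n; s≤s; s≤s⁻¹; z<s; s<s; NonZero)
open import Data.Nat.GeneralisedArithmetic using () renaming (iterate to iter)
open import Data.Nat.ListAction using (sum)
open import Data.Nat.Properties
open import Algebra.Properties.CommutativeSemigroup +-commutativeSemigroup using (interchange; x∙yz≈y∙xz; xy∙z≈xz∙y)
open import Data.Product using (Σ-syntax; ∃-syntax; _×_; _,_; proj₁; proj₂)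
open import Function using (_∘_; _⇔_; mk⇔)
open import Function.Bundles using (Bijection)
open import Relation.Binary.Bundles using (Setoid)
open import Relation.Binary.PropositionalEquality
open import Relation.Nullary using (does; ¬?; contradiction)
open import Relation.Nullary.Decidable using (does-⇔)
open import Relation.Unary using (Decidable)

open DecMembership _≟_ using (_∈?_)

-- The N and D steps of a word.

NonEast : Word → Set
NonEast = All (_≢ E)

nonEast : Word → Word
nonEast = filter (λ s → ¬? (s ≟ˢ E))

-- For γ in {NE,D}ⁿ this is the last word of `φ γ`, from which no exchange is possible.
final : Word → Word
final γ = nonEast γ ++ replicate (count N γ) E

length-nonEast : ∀ w → length (nonEast w) ≡ count N w + count D w
length-nonEast []      = refl
length-nonEast (N ∷ w) = cong suc (length-nonEast w)
length-nonEast (E ∷ w) = length-nonEast w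
length-nonEast (D ∷ w) = trans (cong suc (length-nonEast w)) (sym (+-suc (count N w) (count D w)))

NonEast⇒nonEast : ∀ {u} → NonEast u → nonEast u ≡ u
NonEast⇒nonEast {[]}    []       = refl
NonEast⇒nonEast {N ∷ u} (_ ∷ ps) = cong (N ∷_) (NonEast⇒nonEast ps)
NonEast⇒nonEast {E ∷ u} (p ∷ ps) = contradiction refl p
NonEast⇒nonEast {D ∷ u} (_ ∷ ps) = cong (D ∷_) (NonEast⇒nonEast ps)

nonEast-replicate : ∀ m → nonEast (replicate m E) ≡ []
nonEast-replicate zero    = refl
nonEast-replicate (suc m) = nonEast-replicate m

count-Γ : ∀ w → count N (Γ w) ≡ count N w
count-Γ []      = refl
count-Γ (N ∷ w) = cong suc (count-Γ w)
count-Γ (E ∷ w) = count-Γ w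
count-Γ (D ∷ w) = count-Γ w

Γ-NonEast : ∀ {u} → NonEast u → Γ u ≡ replicate (count N u) N
Γ-NonEast {[]}    []       = refl
Γ-NonEast {N ∷ u} (_ ∷ ps) = cong (N ∷_) (Γ-NonEast ps)
Γ-NonEast {E ∷ u} (p ∷ ps) = contradiction refl p
Γ-NonEast {D ∷ u} (_ ∷ ps) = Γ-NonEast ps

Γ-replicate : ∀ m → Γ (replicate m E) ≡ replicate m E
Γ-replicate zero    = refl
Γ-replicate (suc m) = cong (E ∷_) (Γ-replicate m)

-- Area when an E step is delayed.

areaFrom-shift : ∀ x y w → areaFrom (suc x , suc y) w ≡ areaFrom (x , y) w
areaFrom-shift x y []      = refl
areaFrom-shift x y (N ∷ w) = cong (y ∸ x +_) (areaFrom-shift x (suc y) w)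
areaFrom-shift x y (E ∷ w) = areaFrom-shift (suc x) y w
areaFrom-shift x y (D ∷ w) = cong (y ∸ x +_) (areaFrom-shift (suc x) (suc y) w)

-- On the left, each step of `u` starts one unit higher than on the right and contributes one more;
-- `x ≤ y` keeps the truncated subtraction exact. After the E the two paths differ only by a
-- translation along the diagonal.
area-delayE : ∀ {x y u} v → x ≤ y → NonEast u →
              areaFrom (x , suc y) (u ++ E ∷ v) ≡ length u + areaFrom (x , y) (u ++ v)
area-delayE {x} {y} {[]}    v x≤y []       = areaFrom-shift x y v
area-delayE {x} {y} {N ∷ u} v x≤y (_ ∷ ps)
  rewrite +-∸-assoc 1 x≤y | area-delayE v (m≤n⇒m≤1+n x≤y) ps = cong suc (x∙yz≈y∙xz (y ∸ x) (length u) _)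
area-delayE {x} {y} {E ∷ u} v x≤y (p ∷ ps) = contradiction refl p
area-delayE {x} {y} {D ∷ u} v x≤y (_ ∷ ps)
  rewrite +-∸-assoc 1 x≤y | area-delayE v (s≤s x≤y) ps = cong suc (x∙yz≈y∙xz (y ∸ x) (length u) _)

-- Bounce of a word with a block NE in front.

shift : Point → Point
shift (x , y) = suc x , suc y

eastStartsFrom-shift : ∀ x y w → eastStartsFrom (suc x , suc y) w ≡ map shift (eastStartsFrom (x , y) w)
eastStartsFrom-shift x y []      = refl
eastStartsFrom-shift x y (N ∷ w) = eastStartsFrom-shift x (suc y) w
eastStartsFrom-shift x y (E ∷ w) = cong (_ ∷_) (eastStartsFrom-shift (suc x) y w)
eastStartsFrom-shift x y (D ∷ w) = eastStartsFrom-shift (suc x) (suc y) w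

eastStartsFrom-N : ∀ x y a w → eastStartsFrom (x , y) (replicate a N ++ w) ≡ eastStartsFrom (x , y + a) w
eastStartsFrom-N x y zero    w = cong (λ h → eastStartsFrom (x , h) w) (sym (+-identityʳ y))
eastStartsFrom-N x y (suc a) w =
  trans (eastStartsFrom-N x (suc y) a w) (cong (λ h → eastStartsFrom (x , h) w) (sym (+-suc y a)))

eastStartsFrom-E : ∀ x y m → All ((_≡ y) ∘ proj₂) (eastStartsFrom (x , y) (replicate m E))
eastStartsFrom-E x y zero    = []
eastStartsFrom-E x y (suc m) = refl ∷ eastStartsFrom-E (suc x) y m

find-All : ∀ {P Q : Point → Set} (Q? : Decidable Q) {ps} → All P ps → AllMaybe P (find Q? ps)
find-All Q? [] = nothing
find-All Q? {p ∷ _} (px ∷ pxs) with does (Q? p)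
... | true  = just px
... | false = find-All Q? pxs

find-shift : ∀ j ps → find (λ p → proj₁ p ≟ suc j) (map shift ps) ≡ Maybe.map shift (find (λ p → proj₁ p ≟ j) ps)
find-shift j []       = refl
find-shift j (p ∷ ps) with does (proj₁ p ≟ j)
... | true  = refl
... | false = find-shift j ps

turnsFrom-All : ∀ {P : Point → Set} f {ps} j → All P ps → All P (turnsFrom f ps j)
turnsFrom-All zero         j pxs = []
turnsFrom-All (suc f) {ps} j pxs with find (λ p → proj₁ p ≟ j) ps | find-All (λ p → proj₁ p ≟ j) pxs
... | nothing      | _       = []
... | just (x , h) | just px = px ∷ turnsFrom-All f h pxs

turnsFrom-shift : ∀ f ps j → turnsFrom f (map shift ps) (suc j) ≡ map shift (turnsFrom f ps j)
turnsFrom-shift zero    ps j = refl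
turnsFrom-shift (suc f) ps j rewrite find-shift j ps with find (λ p → proj₁ p ≟ j) ps
... | nothing      = refl
... | just (x , h) = cong (_ ∷_) (turnsFrom-shift f ps h)

-- The bounce path never comes back to the line x = 0: every turn found has positive height, so the
-- next line searched again has positive abscissa.
turnsFrom-skip : ∀ f {h ps} j → All ((0 <_) ∘ proj₂) ps →
                 turnsFrom f ((0 , h) ∷ ps) (suc j) ≡ turnsFrom f ps (suc j)
turnsFrom-skip zero         j pxs = refl
turnsFrom-skip (suc f) {h} {ps} j pxs
  with find (λ p → proj₁ p ≟ suc j) ps | find-All (λ p → proj₁ p ≟ suc j) pxs
... | nothing           | _       = refl
... | just (x , suc h′) | just _  = cong (_ ∷_) (turnsFrom-skip f h′ pxs)

-- The bounce path turns at (0,1) and returns to the diagonal at (1,1), from where it is the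
-- translated bounce path of `δ`. The extra N supplies the fuel for the additional bounce.
turns-NE : ∀ δ → turns (N ∷ E ∷ δ) ≡ (0 , 1) ∷ map shift (turns δ)
turns-NE δ = cong ((0 , 1) ∷_) (begin
  turnsFrom (count N δ) ((0 , 1) ∷ eastStartsFrom (1 , 1) δ) 1
    ≡⟨ cong (λ ps → turnsFrom (count N δ) ((0 , 1) ∷ ps) 1) (eastStartsFrom-shift 0 0 δ) ⟩
  turnsFrom (count N δ) ((0 , 1) ∷ map shift (eastStarts δ)) 1
    ≡⟨ turnsFrom-skip (count N δ) 0 (All.map⁺ (All.universal (λ _ → z<s) (eastStarts δ))) ⟩
  turnsFrom (count N δ) (map shift (eastStarts δ)) 1
    ≡⟨ turnsFrom-shift (count N δ) (eastStarts δ) 0 ⟩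
  map shift (turns δ) ∎)
  where open ≡-Reasoning

dyckBounce-NE : ∀ δ → dyckBounce (N ∷ E ∷ δ) ≡ count N δ + dyckBounce δ
dyckBounce-NE δ = trans
  (cong (λ ps → sum (map (λ (_ , h) → suc (count N δ) ∸ h) ps)) (turns-NE δ))
  (cong (λ hs → count N δ + sum hs) (sym (map-∘ (turns δ))))

suc∈0∷map-suc⇔∈ : ∀ e ps → suc e ∈ (0 ∷ map suc ps) ⇔ e ∈ ps
suc∈0∷map-suc⇔∈ e ps = mk⇔
  (λ { (here ()) ; (there e+1∈) → let _ , e∈ , eq = ∈-map⁻ suc e+1∈ in subst (_∈ ps) (sym (suc-injective eq)) e∈ })
  (there ∘ ∈-map⁺ suc)

-- This is the effect of having read one more E in front, at abscissa 0, which is a peak step: each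
-- later D counts it once, and the later E steps, their abscissas raised by one, are peak steps
-- exactly when they were before.
numphFrom-shift : ∀ ps e p w → numphFrom (0 ∷ map suc ps) (suc e) (suc p) w ≡ count D w + numphFrom ps e p w
numphFrom-shift ps e p []      = refl
numphFrom-shift ps e p (N ∷ w) = numphFrom-shift ps e p w
numphFrom-shift ps e p (E ∷ w)
  rewrite does-⇔ (suc∈0∷map-suc⇔∈ e ps) (suc e ∈? (0 ∷ map suc ps)) (e ∈? ps)
  with does (e ∈? ps)
... | true  = numphFrom-shift ps (suc e) (suc p) w
... | false = numphFrom-shift ps (suc e) p w
numphFrom-shift ps e p (D ∷ w) = cong suc (begin
  p + numphFrom (0 ∷ map suc ps) (suc e) (suc p) w ≡⟨ cong (p +_) (numphFrom-shift ps e p w) ⟩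
  p + (count D w + numphFrom ps e p w)             ≡⟨ x∙yz≈y∙xz p (count D w) _ ⟩
  count D w + (p + numphFrom ps e p w)             ∎)
  where open ≡-Reasoning

numph-NE : ∀ w → numph (N ∷ E ∷ w) ≡ count D w + numph w
numph-NE w = begin
  numphFrom (map proj₁ (turns (N ∷ E ∷ Γ w))) 0 0 (N ∷ E ∷ w)
    ≡⟨ cong (λ ps → numphFrom (map proj₁ ps) 0 0 (N ∷ E ∷ w)) (turns-NE (Γ w)) ⟩
  numphFrom (0 ∷ map proj₁ (map shift ts)) 1 1 w
    -- Both lists equal `map (suc ∘ proj₁) ts`, because `proj₁ ∘ shift` and `suc ∘ proj₁` agree
    -- definitionally.
    ≡⟨ cong (λ xs → numphFrom (0 ∷ xs) 1 1 w) (trans (sym (map-∘ ts)) (map-∘ ts)) ⟩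
  numphFrom (0 ∷ map suc (map proj₁ ts)) 1 1 w
    ≡⟨ numphFrom-shift (map proj₁ ts) 0 0 w ⟩
  count D w + numph w ∎
  where
  open ≡-Reasoning
  ts = turns (Γ w)

-- The N steps of `w` are gained in the bounce of the Dyck path, the D steps in `numph`; together
-- they are the non-E steps.
bounce-NE : ∀ w → bounce (N ∷ E ∷ w) ≡ length (nonEast w) + bounce w
bounce-NE w = begin
  dyckBounce (N ∷ E ∷ Γ w) + numph (N ∷ E ∷ w)
    ≡⟨ cong₂ _+_ (dyckBounce-NE (Γ w)) (numph-NE w) ⟩
  count N (Γ w) + dyckBounce (Γ w) + (count D w + numph w)
    ≡⟨ interchange (count N (Γ w)) (dyckBounce (Γ w)) (count D w) (numph w) ⟩
  count N (Γ w) + count D w + bounce w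
    ≡⟨ cong (λ c → c + count D w + bounce w) (count-Γ w) ⟩
  count N w + count D w + bounce w
    ≡⟨ cong (_+ bounce w) (sym (length-nonEast w)) ⟩
  length (nonEast w) + bounce w ∎
  where open ≡-Reasoning

-- Bounce while an E step is under way.

-- What `Γ` leaves of a word in which one E is travelling: `a` and `b` count the N steps that it has
-- passed and those still ahead of it, `m` the E steps already at the end.
detourPath : ℕ → ℕ → ℕ → Word
detourPath a b m = N ∷ replicate a N ++ E ∷ replicate b N ++ replicate m E

count-N-replicate : ∀ a w → count N (replicate a N ++ w) ≡ a + count N w
count-N-replicate zero    w = refl
count-N-replicate (suc a) w = cong suc (count-N-replicate a w)

count-N-E : ∀ m → count N (replicate m E) ≡ 0
count-N-E zero    = refl
count-N-E (suc m) = count-N-E m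

count-detour : ∀ a b m → count N (detourPath a b m) ≡ suc a + b
count-detour a b m
  rewrite count-N-replicate a (E ∷ replicate b N ++ replicate m E)
        | count-N-replicate b (replicate m E) | count-N-E m | +-identityʳ b = refl

-- The turns after the first are at full height, so they contribute nothing to
-- the bounce.
turns-detour : ∀ a b m → ∃[ ps ] (turns (detourPath a b m) ≡ (0 , suc a) ∷ ps × All ((_≡ suc a + b) ∘ proj₂) ps)
turns-detour a b m
  rewrite eastStartsFrom-N 0 1 a (E ∷ replicate b N ++ replicate m E)
        | eastStartsFrom-N 1 (suc a) b (replicate m E)
  = _ , cong ((0 , suc a) ∷_) (turnsFrom-skip f a (All.map (λ { refl → z<s }) tops)) , turnsFrom-All f (suc a) tops
  where
  f = count N (replicate a N ++ E ∷ replicate b N ++ replicate m E)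
  tops = eastStartsFrom-E 1 (suc a + b) m

sum-zero : ∀ {f : Point → ℕ} {ps} → All ((_≡ 0) ∘ f) ps → sum (map f ps) ≡ 0
sum-zero []       = refl
sum-zero (z ∷ zs) = cong₂ _+_ z (sum-zero zs)

dyckBounce-detour : ∀ a b m → dyckBounce (detourPath a b m) ≡ b
dyckBounce-detour a b m = let ps , eq , tops = turns-detour a b m in begin
  sum (map (λ (_ , h) → count N (detourPath a b m) ∸ h) (turns (detourPath a b m)))
    ≡⟨ cong₂ (λ c qs → sum (map (λ (_ , h) → c ∸ h) qs)) (count-detour a b m) eq ⟩
  suc a + b ∸ suc a + sum (map (λ (_ , h) → suc a + b ∸ h) ps)
    ≡⟨ cong₂ _+_ (m+n∸m≡n (suc a) b) (sum-zero (All.map (λ { refl → n∸n≡0 (suc a + b) }) tops)) ⟩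
  b + 0
    ≡⟨ +-identityʳ b ⟩
  b ∎
  where open ≡-Reasoning

numphFrom-NonEast : ∀ ps e p {u} v → NonEast u →
                    numphFrom ps e p (u ++ v) ≡ count D u * p + numphFrom ps e p v
numphFrom-NonEast ps e p {[]}    v []       = refl
numphFrom-NonEast ps e p {N ∷ u} v (_ ∷ qs) = numphFrom-NonEast ps e p v qs
numphFrom-NonEast ps e p {E ∷ u} v (q ∷ qs) = contradiction refl q
numphFrom-NonEast ps e p {D ∷ u} v (_ ∷ qs) =
  trans (cong (p +_) (numphFrom-NonEast ps e p v qs)) (sym (+-assoc p (count D u * p) _))

numphFrom-E : ∀ ps e p m → numphFrom ps e p (replicate m E) ≡ 0
numphFrom-E ps e p zero    = refl
numphFrom-E ps e p (suc m) = numphFrom-E ps (suc e) _ m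

-- The travelling E is the first peak step. It is the only one before the D steps of `y`, none
-- precedes those of `x`, and the Dyck path contributes the N steps of `y`. The total is the number
-- of steps that this E still has to pass.
bounce-detour : ∀ {x y} m → NonEast x → NonEast y →
                bounce (N ∷ x ++ E ∷ y ++ replicate m E) ≡ length y
bounce-detour {x} {y} m px py = begin
  dyckBounce (Γ w) + numph w ≡⟨ cong₂ _+_ (trans (cong dyckBounce Γ-w) (dyckBounce-detour a b m)) numph-w ⟩
  count N y + count D y      ≡⟨ sym (length-nonEast y) ⟩
  length (nonEast y)         ≡⟨ cong length (NonEast⇒nonEast py) ⟩
  length y                   ∎
  where
  open ≡-Reasoning
  w = N ∷ x ++ E ∷ y ++ replicate m E
  a = count N x
  b = count N y
  Γ-w : Γ w ≡ detourPath a b m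
  Γ-w rewrite filter-++ (λ s → ¬? (s ≟ˢ D)) x (E ∷ y ++ replicate m E)
    | filter-++ (λ s → ¬? (s ≟ˢ D)) y (replicate m E)
    | Γ-NonEast px | Γ-NonEast py | Γ-replicate m = refl
  numph-w : numph w ≡ count D y
  numph-w = let ps , eq , _ = turns-detour a b m ; peaks = 0 ∷ map proj₁ ps in begin
    numphFrom (map proj₁ (turns (Γ w))) 0 0 w
      ≡⟨ cong (λ qs → numphFrom (map proj₁ qs) 0 0 w) (trans (cong turns Γ-w) eq) ⟩
    numphFrom peaks 0 0 (x ++ E ∷ y ++ replicate m E)
      ≡⟨ numphFrom-NonEast peaks 0 0 (E ∷ y ++ replicate m E) px ⟩
    count D x * 0 + numphFrom peaks 1 1 (y ++ replicate m E)
      ≡⟨ cong₂ _+_ (*-zeroʳ (count D x)) (numphFrom-NonEast peaks 1 1 (replicate m E) py) ⟩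
    count D y * 1 + numphFrom peaks 1 1 (replicate m E)
      -- The E steps at the end may be peak steps too, but no D follows them.
      ≡⟨ cong₂ _+_ (*-identityʳ (count D y)) (numphFrom-E peaks 1 1 m) ⟩
    count D y + 0
      ≡⟨ +-identityʳ (count D y) ⟩
    count D y ∎

-- The words that occur in the sequence of γ.

-- In detour, the E of the first block is on its way through the N and D steps
-- x ++ y of γ, and all the E steps of γ have already reached the end.
data Reach : Word → Word → Set where
  []     : Reach [] []
  NE∷_   : ∀ {γ w} → Reach γ w → Reach (N ∷ E ∷ γ) (N ∷ E ∷ w)
  D∷_    : ∀ {γ w} → Reach γ w → Reach (D ∷ γ) (D ∷ w)
  detour : ∀ {γ} x y → x ++ y ≡ nonEast γ →
           Reach (N ∷ E ∷ γ) (N ∷ x ++ E ∷ y ++ replicate (count N γ) E)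

Reach-refl : ∀ {n γ} → ⟨NE,D⟩^ n γ → Reach γ γ
Reach-refl []      = []
Reach-refl (NE∷ γ) = NE∷ Reach-refl γ
Reach-refl (D∷ γ)  = D∷ Reach-refl γ

NonEast-split : ∀ γ x y → x ++ y ≡ nonEast γ → NonEast x × NonEast y
NonEast-split γ x y eq = All.++⁻ x (subst NonEast (sym eq) (All.all-filter (λ s → ¬? (s ≟ˢ E)) γ))

-- This invariant keeps the increment in `bounce-NE` constant along the sequence, and it lets γ be
-- recovered from `w`.
nonEast-Reach : ∀ {γ w} → Reach γ w → nonEast w ≡ nonEast γ
nonEast-Reach []      = refl
nonEast-Reach (NE∷ r) = cong (N ∷_) (nonEast-Reach r)
nonEast-Reach (D∷ r)  = cong (D ∷_) (nonEast-Reach r)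
nonEast-Reach (detour {γ} x y eq)
  rewrite filter-++ (λ s → ¬? (s ≟ˢ E)) x (E ∷ y ++ replicate (count N γ) E)
        | filter-++ (λ s → ¬? (s ≟ˢ E)) y (replicate (count N γ) E)
        | nonEast-replicate (count N γ) | ++-identityʳ (nonEast y)
        | NonEast⇒nonEast (proj₁ (NonEast-split γ x y eq)) | NonEast⇒nonEast (proj₂ (NonEast-split γ x y eq))
  = cong (N ∷_) eq

-- Area and its sum with bounce.

area-NE : ∀ w → area (N ∷ E ∷ w) ≡ area w
area-NE w = areaFrom-shift 0 0 w

area-D : ∀ w → area (D ∷ w) ≡ area w
area-D w = areaFrom-shift 0 0 w

area-detour : ∀ γ x y → x ++ y ≡ nonEast γ →
              area (N ∷ x ++ E ∷ y ++ replicate (count N γ) E) ≡ length x + area (final γ)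
area-detour γ x y eq = begin
  areaFrom (0 , 1) (x ++ E ∷ y ++ es) ≡⟨ area-delayE (y ++ es) z≤n (proj₁ (NonEast-split γ x y eq)) ⟩
  length x + area (x ++ y ++ es)      ≡⟨ cong (λ w → length x + area w) (sym (++-assoc x y es)) ⟩
  length x + area ((x ++ y) ++ es)    ≡⟨ cong (λ w → length x + area (w ++ es)) eq ⟩
  length x + area (final γ)           ∎
  where
  open ≡-Reasoning
  es = replicate (count N γ) E

-- The E of a leading block passes every N and D step behind it, and `bounce-NE` counts the same
-- steps.
area-final : ∀ {n γ} → ⟨NE,D⟩^ n γ → area (final γ) ≡ bounce γ
area-final []              = refl
area-final (D∷_ {w = γ} p) = trans (area-D (final γ)) (area-final p)
area-final (NE∷_ {w = γ} p) = begin
  -- The final word is the detour with empty `y`: its E has passed everything.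
  area (final (N ∷ E ∷ γ))                ≡⟨ area-detour γ (nonEast γ) [] (++-identityʳ (nonEast γ)) ⟩
  length (nonEast γ) + area (final γ)     ≡⟨ cong (length (nonEast γ) +_) (area-final p) ⟩
  length (nonEast γ) + bounce γ           ≡⟨ sym (bounce-NE γ) ⟩
  bounce (N ∷ E ∷ γ)                      ∎
  where open ≡-Reasoning

-- In a detour the passed steps `x` count for the area and the remaining steps `y` for the bounce;
-- together they are the non-E steps of γ, which is the increment in `bounce-NE`. The rest is
-- `area (final γ)`, equal to `bounce γ`.
area+bounce : ∀ {n γ w} → ⟨NE,D⟩^ n γ → Reach γ w → area w + bounce w ≡ bounce γ
area+bounce [] [] = refl
area+bounce (NE∷ p) (NE∷_ {γ} {w} r) = begin
  area (N ∷ E ∷ w) + bounce (N ∷ E ∷ w)     ≡⟨ cong₂ _+_ (area-NE w) (bounce-NE w) ⟩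
  area w + (length (nonEast w) + bounce w)  ≡⟨ x∙yz≈y∙xz (area w) (length (nonEast w)) (bounce w) ⟩
  length (nonEast w) + (area w + bounce w)  ≡⟨ cong₂ _+_ (cong length (nonEast-Reach r)) (area+bounce p r) ⟩
  length (nonEast γ) + bounce γ             ≡⟨ sym (bounce-NE γ) ⟩
  bounce (N ∷ E ∷ γ)                        ∎
  where open ≡-Reasoning
-- No peak step precedes a leading D, so `bounce (D ∷ w)` reduces to `bounce w`, and likewise for γ.
area+bounce (D∷ p) (D∷_ {w = w} r) = trans (cong (_+ bounce w) (area-D w)) (area+bounce p r)
area+bounce (NE∷ p) (detour {γ} x y eq) = begin
  area w + bounce w                        ≡⟨ cong₂ _+_ (area-detour γ x y eq)
                                                (let px , py = NonEast-split γ x y eq in bounce-detour (count N γ) px py) ⟩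
  length x + area (final γ) + length y     ≡⟨ xy∙z≈xz∙y (length x) (area (final γ)) (length y) ⟩
  length x + length y + area (final γ)     ≡⟨ cong₂ _+_ (sym (length-++ x)) (area-final p) ⟩
  length (x ++ y) + bounce γ               ≡⟨ cong (λ u → length u + bounce γ) eq ⟩
  length (nonEast γ) + bounce γ            ≡⟨ sym (bounce-NE γ) ⟩
  bounce (N ∷ E ∷ γ)                       ∎
  where
  open ≡-Reasoning
  w = N ∷ x ++ E ∷ y ++ replicate (count N γ) E

-- The exchanges of the algorithm.

exchangeHead-nothing : ∀ {s} w → s ≢ E → exchangeHead s w ≡ nothing
exchangeHead-nothing {N} w s≢E = refl
exchangeHead-nothing {E} w s≢E = contradiction refl s≢E
exchangeHead-nothing {D} w s≢E = refl

exchange-∷ : ∀ s w {w′} → exchange w ≡ just w′ → exchange (s ∷ w) ≡ just (s ∷ w′)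
exchange-∷ s w eq rewrite eq = refl

exchange-++ : ∀ u w {w′} → exchange w ≡ just w′ → exchange (u ++ w) ≡ just (u ++ w′)
exchange-++ []      w eq = eq
exchange-++ (s ∷ u) w eq = exchange-∷ s (u ++ w) (exchange-++ u w eq)

exchange-nothing-∷ : ∀ s w → s ≢ E → exchange w ≡ nothing → exchange (s ∷ w) ≡ nothing
exchange-nothing-∷ s w s≢E eq rewrite eq = exchangeHead-nothing w s≢E

exchange-E : ∀ m → exchange (replicate m E) ≡ nothing
exchange-E zero          = refl
exchange-E (suc zero)    = refl
exchange-E (suc (suc m)) rewrite exchange-E (suc m) = refl

exchange-nothing : ∀ u m → NonEast u → exchange (u ++ replicate m E) ≡ nothing
exchange-nothing []      m []       = exchange-E m
exchange-nothing (s ∷ u) m (p ∷ ps) = exchange-nothing-∷ s (u ++ replicate m E) p (exchange-nothing u m ps)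

exchange-E∷ : ∀ s w → s ≢ E → exchange (s ∷ w) ≡ nothing → exchange (E ∷ s ∷ w) ≡ just (s ∷ E ∷ w)
exchange-E∷ N w s≢E eq rewrite eq = refl
exchange-E∷ E w s≢E eq = contradiction refl s≢E
exchange-E∷ D w s≢E eq rewrite eq = refl

-- To the right of the travelling E only E steps follow an E, so the largest index is that of the
-- travelling E itself. Passing `s` lengthens the stretch behind it by one, and `area-detour` turns
-- this into one unit of area.
exchange-detour : ∀ γ x s y → x ++ s ∷ y ≡ nonEast γ →
  let w  = N ∷ x ++ E ∷ s ∷ y ++ replicate (count N γ) E
      w′ = N ∷ (x ++ s ∷ []) ++ E ∷ y ++ replicate (count N γ) E in
  exchange w ≡ just w′ × Reach (N ∷ E ∷ γ) w′ × area w′ ≡ suc (area w)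
exchange-detour γ x s y eq = step , detour (x ++ s ∷ []) y eq′ , (begin
  area w′ ≡⟨ area-detour γ (x ++ s ∷ []) y eq′ ⟩
  length (x ++ s ∷ []) + area (final γ) ≡⟨ cong (_+ area (final γ)) (trans (length-++ x) (+-comm (length x) 1)) ⟩
  suc (length x + area (final γ)) ≡⟨ cong suc (sym (area-detour γ x (s ∷ y) eq)) ⟩
  suc (area w) ∎)
  where
  open ≡-Reasoning
  es = replicate (count N γ) E
  w  = N ∷ x ++ E ∷ s ∷ y ++ es
  w′ = N ∷ (x ++ s ∷ []) ++ E ∷ y ++ es
  eq′ : (x ++ s ∷ []) ++ y ≡ nonEast γ
  eq′ = trans (++-assoc x (s ∷ []) y) eq
  step : exchange w ≡ just w′
  step with NonEast-split γ x (s ∷ y) eq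
  ... | _ , ps ∷ py = subst (λ v → exchange w ≡ just (N ∷ v)) (sym (++-assoc x (s ∷ []) (E ∷ y ++ es)))
    (exchange-++ (N ∷ x) (E ∷ s ∷ y ++ es)
      (exchange-E∷ s (y ++ es) ps (exchange-nothing (s ∷ y) (count N γ) (ps ∷ py))))


-- `done` records the exact word because a preceding block NE can start its detour only once the
-- word behind it is final.
data Progress (γ w : Word) : Set where
  step : ∀ {w′} → exchange w ≡ just w′ → Reach γ w′ → area w′ ≡ suc (area w) → Progress γ w
  done : exchange w ≡ nothing → w ≡ final γ → Progress γ w

progress-detour : ∀ γ x y → x ++ y ≡ nonEast γ →
                  Progress (N ∷ E ∷ γ) (N ∷ x ++ E ∷ y ++ replicate (count N γ) E)
progress-detour γ x []      eq = done
  -- With nothing left to pass, the travelling E joins the E steps at the end, hence the `suc`.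
  (exchange-nothing (N ∷ x) (suc (count N γ)) ((λ ()) ∷ proj₁ (NonEast-split γ x [] eq)))
  (cong (λ u → N ∷ u ++ E ∷ replicate (count N γ) E) (trans (sym (++-identityʳ x)) eq))
progress-detour γ x (s ∷ y) eq = let eq₁ , r , eq₂ = exchange-detour γ x s y eq in step eq₁ r eq₂

progress : ∀ {γ w} → Reach γ w → Progress γ w
progress [] = done refl refl
progress (NE∷_ {γ} {w} r) with progress r
... | step {w′} eq r′ up = step (exchange-∷ N (E ∷ w) (exchange-∷ E w eq)) (NE∷ r′)
                             (trans (area-NE w′) (trans up (cong suc (sym (area-NE w)))))
-- The word behind the block is `final γ`, so `N ∷ E ∷ final γ` is already a detour with nothing
-- passed yet, and its E moves next.
... | done eq refl       = progress-detour γ [] (nonEast γ) refl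
progress (D∷_ {γ} {w} r) with progress r
... | step {w′} eq r′ up = step (exchange-∷ D w eq) (D∷ r′)
                             (trans (area-D w′) (trans up (cong suc (sym (area-D w)))))
... | done eq refl       = done (exchange-nothing-∷ D (final γ) (λ ()) eq) refl
progress (detour {γ} x y eq) = progress-detour γ x y eq

-- Area and bounce at each index of the sequence.

next-Reach : ∀ {n γ w} → ⟨NE,D⟩^ n γ → Reach γ w → area w < bounce γ →
             Reach γ (next w) × area (next w) ≡ suc (area w)
next-Reach {w = w} p r a<b with progress r
... | step eq r′ up rewrite eq = r′ , up
-- The default of `next` is never taken here: the final word has area `bounce γ`, against the strict
-- bound.
... | done eq refl = contradiction (area-final p) (<⇒≢ a<b)

iterate-Reach : ∀ {n γ w} v → ⟨NE,D⟩^ n γ → Reach γ w → v + area w ≤ bounce γ →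
                Reach γ (iter next w v) × area (iter next w v) ≡ v + area w
iterate-Reach zero p r le = r , refl
iterate-Reach {γ = γ} {w} (suc v) p r le =
  let r₁ , eq₁ = next-Reach p r (m+n≤o⇒n≤o v (subst (_≤ bounce γ) (sym (+-suc v (area w))) le))
      shifted  = trans (cong (v +_) eq₁) (+-suc v (area w))
      r₂ , eq₂ = iterate-Reach v p r₁ (subst (_≤ bounce γ) (sym shifted) le)
  in r₂ , trans eq₂ shifted

area-⟨NE,D⟩ : ∀ {n γ} → ⟨NE,D⟩^ n γ → area γ ≡ 0
area-⟨NE,D⟩ []               = refl
area-⟨NE,D⟩ (NE∷_ {w = w} p) = trans (area-NE w) (area-⟨NE,D⟩ p)
area-⟨NE,D⟩ (D∷_ {w = w} p)  = trans (area-D w) (area-⟨NE,D⟩ p)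

module _ {n γ} (p : ⟨NE,D⟩^ n γ) {v} (v≤b : v ≤ bounce γ) where

  private
    reached : Reach γ (iter next γ v) × area (iter next γ v) ≡ v + area γ
    reached = iterate-Reach v p (Reach-refl p)
      (subst (_≤ bounce γ) (sym (trans (cong (v +_) (area-⟨NE,D⟩ p)) (+-identityʳ v))) v≤b)

  Reach-iterate : Reach γ (iter next γ v)
  Reach-iterate = proj₁ reached

  area-iterate : area (iter next γ v) ≡ v
  area-iterate = trans (proj₂ reached) (trans (cong (v +_) (area-⟨NE,D⟩ p)) (+-identityʳ v))

  bounce-iterate : bounce (iter next γ v) ≡ bounce γ ∸ v
  bounce-iterate = sym (begin
    bounce γ ∸ v               ≡⟨ cong₂ _∸_ (sym (area+bounce p Reach-iterate)) (sym area-iterate) ⟩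
    area w + bounce w ∸ area w ≡⟨ m+n∸m≡n (area w) (bounce w) ⟩
    bounce w                   ∎)
    where
    open ≡-Reasoning
    w = iter next γ v

-- Recovering γ from a word of its sequence.

restoreE : Word → Word
restoreE []      = []
restoreE (N ∷ w) = N ∷ E ∷ restoreE w
restoreE (E ∷ w) = restoreE w
restoreE (D ∷ w) = D ∷ restoreE w

restoreE-nonEast : ∀ w → restoreE (nonEast w) ≡ restoreE w
restoreE-nonEast []      = refl
restoreE-nonEast (N ∷ w) = cong (λ u → N ∷ E ∷ u) (restoreE-nonEast w)
restoreE-nonEast (E ∷ w) = restoreE-nonEast w
restoreE-nonEast (D ∷ w) = cong (D ∷_) (restoreE-nonEast w)

restoreE-⟨NE,D⟩ : ∀ {n γ} → ⟨NE,D⟩^ n γ → restoreE γ ≡ γ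
restoreE-⟨NE,D⟩ []      = refl
restoreE-⟨NE,D⟩ (NE∷ p) = cong (λ u → N ∷ E ∷ u) (restoreE-⟨NE,D⟩ p)
restoreE-⟨NE,D⟩ (D∷ p)  = cong (D ∷_) (restoreE-⟨NE,D⟩ p)

-- Words of {NE,D}ⁿ are determined by their N and D steps, which the sequence preserves. Hence the
-- sequences of different γ are disjoint.
restoreE-Reach : ∀ {n γ w} → ⟨NE,D⟩^ n γ → Reach γ w → restoreE w ≡ γ
restoreE-Reach {γ = γ} {w} p r = begin
  restoreE w           ≡⟨ sym (restoreE-nonEast w) ⟩
  restoreE (nonEast w) ≡⟨ cong restoreE (nonEast-Reach r) ⟩
  restoreE (nonEast γ) ≡⟨ restoreE-nonEast γ ⟩
  restoreE γ           ≡⟨ restoreE-⟨NE,D⟩ p ⟩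
  γ                    ∎
  where open ≡-Reasoning

-- Indices in the sequences and their reversal.

∈-iterate⁻ : ∀ {A : Set} {f : A → A} {x y} n → y ∈ iterate f x n → ∃[ v ] (v < n × y ≡ iter f x v)
∈-iterate⁻ (suc n) (here refl) = 0 , z<s , refl
∈-iterate⁻ (suc n) (there y∈)  = let v , v<n , eq = ∈-iterate⁻ n y∈ in suc v , s<s v<n , eq

∈-iterate⁺ : ∀ {A : Set} (f : A → A) x {n v} → v < n → iter f x v ∈ iterate f x n
∈-iterate⁺ f x {suc n} {zero}  v<n       = here refl
∈-iterate⁺ f x {suc n} {suc v} (s<s v<n) = there (∈-iterate⁺ f (f x) v<n)

-- It depends on the word alone and not on a membership proof, so it respects the equality of the
-- setoid. At index v of `φ γ` the bounce is `bounce γ ∸ v`, the mirrored index.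
reverse : Word → Word
reverse π = iter next (restoreE π) (bounce π)

reverse-iterate : ∀ {n γ v} → ⟨NE,D⟩^ n γ → v ≤ bounce γ →
                  reverse (iter next γ v) ≡ iter next γ (bounce γ ∸ v)
reverse-iterate p v≤b = cong₂ (iter next) (restoreE-Reach p (Reach-iterate p v≤b)) (bounce-iterate p v≤b)

module _ {n π} (π∈ : π ∈φ⟨NE,D⟩^ n) where

  private
    γ : Word
    γ = proj₁ π∈

    p : ⟨NE,D⟩^ n γ
    p = proj₁ (proj₂ π∈)

    index : ∃[ v ] (v < suc (bounce γ) × π ≡ iter next γ v)
    index = ∈-iterate⁻ (suc (bounce γ)) (proj₂ (proj₂ π∈))

    v : ℕ
    v = proj₁ index

    v≤b : v ≤ bounce γ
    v≤b = s≤s⁻¹ (proj₁ (proj₂ index))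

    b∸v≤b : bounce γ ∸ v ≤ bounce γ
    b∸v≤b = m∸n≤m (bounce γ) v

    π≡ : π ≡ iter next γ v
    π≡ = proj₂ (proj₂ index)

    reverse-π : reverse π ≡ iter next γ (bounce γ ∸ v)
    reverse-π = trans (cong reverse π≡) (reverse-iterate p v≤b)

  reverse-∈ : reverse π ∈φ⟨NE,D⟩^ n
  reverse-∈ = γ , p , subst (_∈ φ γ) (sym reverse-π) (∈-iterate⁺ next γ (s≤s b∸v≤b))

  reverse-involutive : reverse (reverse π) ≡ π
  reverse-involutive = begin
    reverse (reverse π)                         ≡⟨ cong reverse reverse-π ⟩
    reverse (iter next γ (bounce γ ∸ v))        ≡⟨ reverse-iterate p b∸v≤b ⟩
    iter next γ (bounce γ ∸ (bounce γ ∸ v))     ≡⟨ cong (iter next γ) (m∸[m∸n]≡n v≤b) ⟩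
    iter next γ v                               ≡⟨ sym π≡ ⟩
    π                                           ∎
    where open ≡-Reasoning

  area-reverse : bounce π ≡ area (reverse π)
  area-reverse = begin
    bounce π                          ≡⟨ cong bounce π≡ ⟩
    bounce (iter next γ v)            ≡⟨ bounce-iterate p v≤b ⟩
    bounce γ ∸ v                      ≡⟨ sym (area-iterate p b∸v≤b) ⟩
    area (iter next γ (bounce γ ∸ v)) ≡⟨ cong area (sym reverse-π) ⟩
    area (reverse π)                  ∎
    where open ≡-Reasoning

proposition1 : (n : ℕ) → .{{_ : NonZero n}} →
    Σ[ Ω ∈ Bijection (φ⟨NE,D⟩^ n) (φ⟨NE,D⟩^ n) ]
    ((π : Setoid.Carrier (φ⟨NE,D⟩^ n)) →
    (area (proj₁ π) ≡ bounce (proj₁ (Bijection.to Ω π))) ×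
    (bounce (proj₁ π) ≡ area (proj₁ (Bijection.to Ω π))))
proposition1 n =
  record
    { to        = λ (π , π∈) → reverse π , reverse-∈ π∈
    ; cong      = cong reverse
    -- `reverse` is an involution, so it serves as its own inverse in both halves.
    ; bijective =
        (λ { {_ , π∈} {_ , ρ∈} eq → trans (sym (reverse-involutive π∈)) (trans (cong reverse eq) (reverse-involutive ρ∈)) }) ,
        (λ (π , π∈) → (reverse π , reverse-∈ π∈) , λ eq → trans (cong reverse eq) (reverse-involutive π∈))
    } ,
  λ (π , π∈) →
    -- The first equation is the second one for `reverse π`, whose reversal is π again.
    trans (sym (cong area (reverse-involutive π∈))) (sym (area-reverse (reverse-∈ π∈))) ,
    area-reverse π∈
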